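{- For every positive integer $t$ there is a graph $G$ such that $dis_{\ell}[G]-dis[G]\geq t$.
   Context: All graphs are finite, undirected, without loops or multiple edges. Natural numbers are positive integers. For a vertex $v$ of a graph $G$, $N[v]$ denotes the closed neighborhood of $v$ (i.e. $v$ together with its neighbors). A labeling $f$ of $V(G)$ by numbers is closed distinguishing if for any two adjacent vertices $u,v$ with $N[u]\neq N[v]$ we have $\sum_{w\in N[u]} f(w)\neq \sum_{w\in N[v]} f(w)$. The closed distinguishing number $dis[G]$ is the smallest positive integer $k$ such that $G$ has a closed distinguishing labeling $f:V(G)\to\{1,2,\ldots,k\}$. The graph $G$ is closed distinguishing $k$-choosable if for every assignment of lists $L(v)$ of $k$ natural numbers to the vertices $v$ of $G$, there is a closed distinguishing labeling $f$ of $G$ with $f(v)\in L(v)$ for each $v\in V(G)$. The closed distinguishing choice number $dis_{\ell}[G]$ is the minimum natural number $k$ such that $G$ is closed distinguishing $k$-choosable. -}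

module Defs where

open import Data.List.Base using (List; allFin; filter; map)
open import Data.Nat.Base using (ℕ; _≤_)
open import Data.Nat.ListAction using (sum)
open import Data.Fin.Base using (Fin)
open import Data.Fin.Properties using (inj⇒≟)
open import Data.Product.Base using (_×_; ∃-syntax)
open import Data.Sum.Base using (_⊎_)
open import Data.Vec.Base using (Vec)
open import Data.Vec.Membership.Propositional using () renaming (_∈_ to _∈ᵥ_)
open import Data.Vec.Relation.Unary.All using (All)
open import Data.Vec.Relation.Unary.Unique.Propositional using (Unique)
open import Function.Bundles using (_↔_; Inverse)
open import Function.Properties.Inverse using (↔⇒↣)
open import Level using (0ℓ)
open import Relation.Binary.Core using (Rel)
open import Relation.Binary.Definitions using (Decidable; DecidableEquality; Symmetric)
open import Relation.Binary.PropositionalEquality.Core using (_≡_; _≢_)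
open import Relation.Nullary.Decidable using (_⊎-dec_)
open import Relation.Nullary.Negation.Core using (¬_)
open import Relation.Unary using (Pred; _≐_) renaming (Decidable to Decidable₁)

record Graph : Set₁ where
  infix 4 _~_ _~?_
  field
    Vertex   : Set
    order    : ℕ
    finite   : Vertex ↔ Fin order
    _~_      : Rel Vertex 0ℓ
    _~?_     : Decidable _~_
    ~-sym    : Symmetric _~_
    ~-irrefl : ∀ v → ¬ (v ~ v)

  infix 4 _≟_
  _≟_ : DecidableEquality Vertex
  _≟_ = inj⇒≟ (↔⇒↣ finite)

  vertices : List Vertex
  vertices = map (Inverse.from finite) (allFin order)

  N[_] : Vertex → Pred Vertex 0ℓ
  N[ v ] w = w ≡ v ⊎ v ~ w

  N[_]? : ∀ v → Decidable₁ N[ v ]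
  N[ v ]? w = (w ≟ v) ⊎-dec (v ~? w)

  ∑N[_] : Vertex → (Vertex → ℕ) → ℕ
  ∑N[ v ] f = sum (map f (filter N[ v ]? vertices))

module _ (G : Graph) where
  open Graph G

  ClosedDistinguishing : (Vertex → ℕ) → Set
  ClosedDistinguishing f =
    ∀ {u v} → u ~ v → ¬ (N[ u ] ≐ N[ v ]) → ∑N[ u ] f ≢ ∑N[ v ] f

  ClosedDistinguishable : ℕ → Set
  ClosedDistinguishable k =
    ∃[ f ] ((∀ v → 1 ≤ f v × f v ≤ k) × ClosedDistinguishing f)

  -- A list of k natural numbers is a set of k distinct positive integers,
  -- hence the uniqueness and positivity hypotheses on L.
  ClosedDistinguishingChoosable : ℕ → Set
  ClosedDistinguishingChoosable k =
    (L : Vertex → Vec ℕ k) →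
    (∀ v → Unique (L v)) →
    (∀ v → All (1 ≤_) (L v)) →
    ∃[ f ] ((∀ v → f v ∈ᵥ L v) × ClosedDistinguishing f)

IsLeastPositive : Pred ℕ 0ℓ → Pred ℕ 0ℓ
IsLeastPositive P k = 1 ≤ k × P k × (∀ j → 1 ≤ j → P j → k ≤ j)

-- The two invariants are stated as relations: choosability quantifies over infinitely many list assignments, so
-- its minimum is not directly available as a constructive function.
dis[_]≡_ : Graph → ℕ → Set
dis[ G ]≡ k = IsLeastPositive (ClosedDistinguishable G) k

disₗ[_]≡_ : Graph → ℕ → Set
disₗ[ G ]≡ k = IsLeastPositive (ClosedDistinguishingChoosable G) k

{-# OPTIONS --safe #-}
-- Every edge of a complete bipartite graph with parts of sizes n and n ^ n is replaced by a gadget that forces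
-- the labels of its two ends to differ, while every other constraint of the gadget can be met by one private
-- vertex as soon as three labels are available. Closed distinguishing labelings thus amount to proper colorings
-- of K_{n, n ^ n}, which is 2-colorable but has choice number n + 1.
module Submission where

open import Defs
open import Data.Nat.Base using (ℕ; _≤_)
open import Data.Integer.Base using (+_; _-_; _≥_)
open import Data.Product.Base using (_×_; ∃-syntax)

open import Data.Fin.Base using (Fin; zero; suc; toℕ; combine; inject≤; finToFun; funToFin)
open import Data.Fin.Properties
  using (+↔⊎; *↔×; inj⇒≟; injective⇒≤; ¬∀⟶∃¬; toℕ-injective; combine-injective;
         inject≤-injective; finToFun-funToFin)
import Data.Integer.Base as ℤ
open import Data.List.Base as List using (List; []; _∷_; allFin; length; map)
open import Data.List.Membership.DecPropositional using (_∈?_)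
open import Data.List.Membership.Propositional using (_∈_; _∉_)
open import Data.List.Membership.Propositional.Properties
  using (∈-allFin; ∈-map⁺; ∈-map⁻; ∈-filter⁺; ∈-filter⁻)
open import Data.List.Membership.Propositional.Properties.WithK using (unique∧set⇒bag)
open import Data.List.Properties using (length-map; length-tabulate)
open import Data.List.Relation.Binary.BagAndSetEquality using (∼bag⇒↭)
import Data.List.Relation.Binary.Permutation.Propositional.Properties as ↭
import Data.List.Relation.Unary.All as All
import Data.List.Relation.Unary.All.Properties as Allₚ
import Data.List.Relation.Unary.Any as Any
open import Data.List.Relation.Unary.Any using (here; there)
import Data.List.Relation.Unary.Any.Properties as Anyₚ
open import Data.List.Relation.Unary.AllPairs using ([]; _∷_)
open import Data.List.Relation.Unary.Unique.Propositional using (Unique)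
import Data.List.Relation.Unary.Unique.Propositional.Properties as Uniqueₚ
open import Data.Nat.Base using (suc; _+_; _*_; _∸_; _^_; _<_; s≤s; z≤n)
open import Data.Nat.ListAction using (sum)
open import Data.Nat.ListAction.Properties using (sum-↭)
open import Data.Nat.Properties
  using (_≟_; ≤-refl; ≤-trans; ≤-antisym; ≤-reflexive; <⇒≢; n≮n; ≰⇒>; m≤m+n; m≤n+m; m≤m*n; m^n≢0;
         suc-injective; m+n∸m≡n; +-cancelˡ-≡; +-cancelʳ-≡; +-monoˡ-≤)
open import Data.Nat.Tactic.RingSolver using (solve-∀)
open import Data.Product.Base using (_,_; proj₁; proj₂)
open import Data.Product.Function.NonDependent.Propositional using (_×-↔_)
open import Data.Sum.Base using (_⊎_; inj₁; inj₂)
open import Data.Sum.Function.Propositional using (_⊎-↔_)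
open import Data.Vec.Base using (Vec; tabulate; lookup)
open import Data.Vec.Membership.Propositional using () renaming (_∈_ to _∈ᵥ_)
open import Data.Vec.Membership.Propositional.Properties using (∈-lookup)
import Data.Vec.Relation.Unary.All as VecAll
import Data.Vec.Relation.Unary.All.Properties as VecAllₚ
import Data.Vec.Relation.Unary.Any.Properties as VecAnyₚ
import Data.Vec.Relation.Unary.Unique.Propositional as Vec
import Data.Vec.Relation.Unary.Unique.Propositional.Properties as VecUnique
open import Function.Base using (_∘_; id)
open import Function.Bundles using (_↔_; Inverse; mk⇔)
open import Function.Properties.Inverse using (↔-refl; ↔-sym; ↔-trans; ↔⇒↣)
open import Relation.Binary.PropositionalEquality
  using (_≡_; _≢_; refl; sym; trans; cong; subst; ≢-sym)
open import Relation.Nullary.Negation using (¬_; contradiction)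
open import Relation.Unary using (_≐_)

-- Closed neighborhood sums over explicit lists.

module _ (G : Graph) where
  open Graph G

  ∈-vertices : ∀ v → v ∈ vertices
  ∈-vertices v =
    subst (_∈ vertices) (Inverse.strictlyInverseʳ finite v) (∈-map⁺ (Inverse.from finite) (∈-allFin _))

  vertices-unique : Unique vertices
  vertices-unique = Uniqueₚ.map⁺ from-injective (Uniqueₚ.allFin⁺ order)
    where
    from-injective : ∀ {i j} → Inverse.from finite i ≡ Inverse.from finite j → i ≡ j
    from-injective {i} {j} eq =
      trans (sym (Inverse.strictlyInverseˡ finite i))
        (trans (cong (Inverse.to finite) eq) (Inverse.strictlyInverseˡ finite j))

  -- Duplicate-free lists with the same members are permutations of each other, and permuting
  -- preserves sums. Any convenient listing of a closed neighborhood can thus replace the filtered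
  -- vertex list.
  ∑N-enumeration : ∀ {v xs} → Unique xs → N[ v ] ≐ (_∈ xs) → ∀ f → ∑N[ v ] f ≡ sum (map f xs)
  ∑N-enumeration {v} xs! (⊆xs , xs⊆) f = sum-↭ (↭.map⁺ f (∼bag⇒↭ (unique∧set⇒bag
    (Uniqueₚ.filter⁺ N[ v ]? vertices-unique) xs!
    (mk⇔ (⊆xs ∘ proj₂ ∘ ∈-filter⁻ N[ v ]? {xs = vertices}) (∈-filter⁺ N[ v ]? (∈-vertices _) ∘ xs⊆)))))

-- Pigeonhole: if every entry of `xs` occurred in `ys`, sending positions in `xs` to positions in
-- `ys` would be an injection into a smaller set.
pick-outside : ∀ {k} {xs : Vec ℕ k} → Vec.Unique xs → (ys : List ℕ) → length ys < k →
               ∃[ x ] (x ∈ᵥ xs × x ∉ ys)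
pick-outside {k} {xs} xs! ys ys<k with ¬∀⟶∃¬ k _ (λ i → _∈?_ _≟_ (lookup xs i) ys) not-all
  where
  not-all : ¬ (∀ i → lookup xs i ∈ ys)
  not-all all = contradiction (≤-trans ys<k (injective⇒≤ {f = Any.index ∘ all} index-injective)) (n≮n _)
    where
    index-injective : ∀ {i j} → Any.index (all i) ≡ Any.index (all j) → i ≡ j
    index-injective {i} {j} eq = VecUnique.lookup-injective xs! i j
      (trans (Anyₚ.lookup-index (all i)) (trans (cong (List.lookup ys) eq) (sym (Anyₚ.lookup-index (all j)))))
... | i , ∉ys = lookup xs i , ∈-lookup i xs , ∉ys

-- The gadget graph.

module Gadgets (n N : ℕ) where

  Vertex : Set
  Vertex = (Fin n ⊎ Fin N) ⊎ (Fin 3 × (Fin n × Fin N))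

  -- The edge between α i and β j of the complete bipartite graph becomes the path α i, u i j, v i j, β j together
  -- with a common neighbor w i j of the two middle vertices.
  pattern α i   = inj₁ (inj₁ i)
  pattern β j   = inj₁ (inj₂ j)
  pattern u i j = inj₂ (zero , (i , j))
  pattern v i j = inj₂ (suc zero , (i , j))
  pattern w i j = inj₂ (suc (suc zero) , (i , j))

  us : Fin n → List Vertex
  us i = map (λ j → u i j) (allFin N)

  vs : Fin N → List Vertex
  vs j = map (λ i → v i j) (allFin n)

  -- Listing the neighbors makes adjacency decidable by list membership and lets `∑N-enumeration`
  -- evaluate the neighborhood sums.
  neighbors : Vertex → List Vertex
  neighbors (α i)   = us i
  neighbors (β j)   = vs j
  neighbors (u i j) = α i ∷ v i j ∷ w i j ∷ []
  neighbors (v i j) = β j ∷ u i j ∷ w i j ∷ []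
  neighbors (w i j) = u i j ∷ v i j ∷ []

  Vertex-finite : Vertex ↔ Fin (n + N + 3 * (n * N))
  Vertex-finite = ↔-sym (↔-trans +↔⊎ (+↔⊎ ⊎-↔ ↔-trans *↔× (↔-refl ×-↔ *↔×)))

  neighbors-sym : ∀ x y → y ∈ neighbors x → x ∈ neighbors y
  neighbors-sym (α i) y p with ∈-map⁻ _ p
  ... | j , _ , refl = here refl
  neighbors-sym (β j) y p with ∈-map⁻ _ p
  ... | i , _ , refl = here refl
  neighbors-sym (u i j) _ (here refl)                 = ∈-map⁺ (λ j → u i j) (∈-allFin j)
  neighbors-sym (u i j) _ (there (here refl))         = there (here refl)
  neighbors-sym (u i j) _ (there (there (here refl))) = here refl
  neighbors-sym (v i j) _ (here refl)                 = ∈-map⁺ (λ i → v i j) (∈-allFin i)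
  neighbors-sym (v i j) _ (there (here refl))         = there (here refl)
  neighbors-sym (v i j) _ (there (there (here refl))) = there (here refl)
  neighbors-sym (w i j) _ (here refl)                 = there (there (here refl))
  neighbors-sym (w i j) _ (there (here refl))         = there (there (here refl))

  closed-unique : ∀ x → Unique (x ∷ neighbors x)
  closed-unique (α i) =
    Allₚ.map⁺ (All.universal (λ _ ()) _) ∷ Uniqueₚ.map⁺ (λ { refl → refl }) (Uniqueₚ.allFin⁺ N)
  closed-unique (β j) =
    Allₚ.map⁺ (All.universal (λ _ ()) _) ∷ Uniqueₚ.map⁺ (λ { refl → refl }) (Uniqueₚ.allFin⁺ n)
  closed-unique (u i j) = ((λ ()) All.∷ (λ ()) All.∷ (λ ()) All.∷ All.[])
    ∷ ((λ ()) All.∷ (λ ()) All.∷ All.[]) ∷ ((λ ()) All.∷ All.[]) ∷ All.[] ∷ []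
  closed-unique (v i j) = ((λ ()) All.∷ (λ ()) All.∷ (λ ()) All.∷ All.[])
    ∷ ((λ ()) All.∷ (λ ()) All.∷ All.[]) ∷ ((λ ()) All.∷ All.[]) ∷ All.[] ∷ []
  closed-unique (w i j) = ((λ ()) All.∷ (λ ()) All.∷ All.[]) ∷ ((λ ()) All.∷ All.[]) ∷ All.[] ∷ []

  G : Graph
  G = record
    { Vertex   = Vertex
    ; order    = n + N + 3 * (n * N)
    ; finite   = Vertex-finite
    ; _~_      = λ x y → y ∈ neighbors x
    ; _~?_     = λ x y → _∈?_ (inj⇒≟ (↔⇒↣ Vertex-finite)) y (neighbors x)
    ; ~-sym    = λ {x} {y} → neighbors-sym x y
    ; ~-irrefl = λ x x∈ → Uniqueₚ.Unique[x∷xs]⇒x∉xs (closed-unique x) x∈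
    }

  open Graph G using (N[_]; ∑N[_])

  -- Neighborhood sums in the gadgets.

  N-enumeration : ∀ x → N[ x ] ≐ (_∈ x ∷ neighbors x)
  N-enumeration x = (λ { (inj₁ refl) → here refl ; (inj₂ y∈) → there y∈ })
                  , (λ { (here refl) → inj₁ refl ; (there y∈) → inj₂ y∈ })

  ∑N-neighbors : ∀ x f → ∑N[ x ] f ≡ sum (map f (x ∷ neighbors x))
  ∑N-neighbors x = ∑N-enumeration G (closed-unique x) (N-enumeration x)

  -- The part common to the sums at `u i j`, `v i j` and `w i j`. They exceed it by `f (α i)`,
  -- `f (β j)` and 0 respectively.
  triangle : (Vertex → ℕ) → Fin n → Fin N → ℕ
  triangle f i j = f (u i j) + f (v i j) + f (w i j)

  ∑N-u : ∀ f i j → ∑N[ u i j ] f ≡ f (α i) + triangle f i j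
  ∑N-u f i j = trans (∑N-neighbors (u i j) f) (rearrange (f (u i j)) (f (α i)) (f (v i j)) (f (w i j)))
    where
    rearrange : ∀ a b c d → a + (b + (c + (d + 0))) ≡ b + (a + c + d)
    rearrange = solve-∀

  ∑N-v : ∀ f i j → ∑N[ v i j ] f ≡ f (β j) + triangle f i j
  ∑N-v f i j = trans (∑N-neighbors (v i j) f) (rearrange (f (u i j)) (f (β j)) (f (v i j)) (f (w i j)))
    where
    rearrange : ∀ a b c d → c + (b + (a + (d + 0))) ≡ b + (a + c + d)
    rearrange = solve-∀

  ∑N-w : ∀ f i j → ∑N[ w i j ] f ≡ triangle f i j
  ∑N-w f i j = trans (∑N-neighbors (w i j) f) (rearrange (f (u i j)) (f (v i j)) (f (w i j)))
    where
    rearrange : ∀ a c d → d + (a + (c + 0)) ≡ a + c + d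
    rearrange = solve-∀

  distinguishing⇒proper : ∀ {f} → ClosedDistinguishing G f → ∀ i j → f (α i) ≢ f (β j)
  distinguishing⇒proper {f} cd i j fα≡fβ = cd {u i j} {v i j} (there (here refl)) N≢
    (trans (∑N-u f i j) (trans (cong (_+ triangle f i j) fα≡fβ) (sym (∑N-v f i j))))
    where
    N≢ : ¬ (N[ u i j ] ≐ N[ v i j ])
    -- The vertex `α i` is adjacent to `u i j` but not to `v i j`.
    N≢ (⊆ , _) with ⊆ {α i} (inj₂ (here refl))
    ... | inj₂ (there (there (there ())))

  -- One hypothesis per kind of edge: `positive` settles the two edges at `w i j`, `proper` the edge
  -- between `u i j` and `v i j`. On the outer edges the label of `α i` or `β j` cancels, which
  -- leaves `us-sum` and `vs-sum`.
  module _ {f : Vertex → ℕ}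
           (positive : ∀ x → 1 ≤ f x)
           (proper   : ∀ i j → f (α i) ≢ f (β j))
           (us-sum   : ∀ i j → sum (map f (us i)) ≢ triangle f i j)
           (vs-sum   : ∀ i j → sum (map f (vs j)) ≢ triangle f i j)
           where

    private
      αu : ∀ i j → ∑N[ α i ] f ≢ ∑N[ u i j ] f
      αu i j eq = us-sum i j (+-cancelˡ-≡ (f (α i)) _ _
        (trans (sym (∑N-neighbors (α i) f)) (trans eq (∑N-u f i j))))

      βv : ∀ i j → ∑N[ β j ] f ≢ ∑N[ v i j ] f
      βv i j eq = vs-sum i j (+-cancelˡ-≡ (f (β j)) _ _
        (trans (sym (∑N-neighbors (β j) f)) (trans eq (∑N-v f i j))))

      uv : ∀ i j → ∑N[ u i j ] f ≢ ∑N[ v i j ] f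
      uv i j eq = proper i j (+-cancelʳ-≡ (triangle f i j) _ _
        (trans (sym (∑N-u f i j)) (trans eq (∑N-v f i j))))

      uw : ∀ i j → ∑N[ u i j ] f ≢ ∑N[ w i j ] f
      uw i j eq = <⇒≢ (+-monoˡ-≤ (triangle f i j) (positive (α i)))
        (sym (trans (sym (∑N-u f i j)) (trans eq (∑N-w f i j))))

      vw : ∀ i j → ∑N[ v i j ] f ≢ ∑N[ w i j ] f
      vw i j eq = <⇒≢ (+-monoˡ-≤ (triangle f i j) (positive (β j)))
        (sym (trans (sym (∑N-v f i j)) (trans eq (∑N-w f i j))))

      adjacent-≢ : ∀ x y → y ∈ neighbors x → ∑N[ x ] f ≢ ∑N[ y ] f
      adjacent-≢ (α i) y y∈ with ∈-map⁻ _ y∈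
      ... | j , _ , refl = αu i j
      adjacent-≢ (β j) y y∈ with ∈-map⁻ _ y∈
      ... | i , _ , refl = βv i j
      adjacent-≢ (u i j) _ (here refl)                 = ≢-sym (αu i j)
      adjacent-≢ (u i j) _ (there (here refl))         = uv i j
      adjacent-≢ (u i j) _ (there (there (here refl))) = uw i j
      adjacent-≢ (v i j) _ (here refl)                 = ≢-sym (βv i j)
      adjacent-≢ (v i j) _ (there (here refl))         = ≢-sym (uv i j)
      adjacent-≢ (v i j) _ (there (there (here refl))) = vw i j
      adjacent-≢ (w i j) _ (here refl)                 = ≢-sym (uw i j)
      adjacent-≢ (w i j) _ (there (here refl))         = ≢-sym (vw i j)

    proper⇒distinguishing : ClosedDistinguishing G f
    proper⇒distinguishing {x} {y} x~y _ = adjacent-≢ x y x~y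

  -- The closed distinguishing number.

  dis≡2 : 3 < n → 3 < N → dis[ G ]≡ 2
  -- Matching on `s≤s` exposes `n` and `N` as successors, so that `α zero` and `β zero` exist in
  -- `least`.
  dis≡2 3<n@(s≤s _) 3<N@(s≤s _) = s≤s z≤n , (f , bounds , f-distinguishing) , least
    where
    f : Vertex → ℕ
    f (α _)    = 1
    f (β _)    = 2
    f (inj₂ _) = 1

    bounds : ∀ x → 1 ≤ f x × f x ≤ 2
    bounds (α _)    = s≤s z≤n , s≤s z≤n
    bounds (β _)    = s≤s z≤n , ≤-refl
    bounds (inj₂ _) = s≤s z≤n , s≤s z≤n

    sum-ones : ∀ {m} (g : Fin m → Fin 3 × (Fin n × Fin N)) → sum (map f (map (inj₂ ∘ g) (allFin m))) ≡ m
    sum-ones {m} g = trans (all-ones (allFin m)) (length-tabulate {n = m} id)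
      where
      all-ones : ∀ xs → sum (map f (map (inj₂ ∘ g) xs)) ≡ length xs
      all-ones []       = refl
      all-ones (_ ∷ xs) = cong suc (all-ones xs)

    f-distinguishing : ClosedDistinguishing G f
    f-distinguishing {x} {y} = proper⇒distinguishing (proj₁ ∘ bounds) (λ _ _ ())
      -- Every triangle has sum 3, while `us i` has sum `N` and `vs j` has sum `n`.
      (λ i j eq → <⇒≢ 3<N (trans (sym eq) (sum-ones (λ j → zero , (i , j)))))
      (λ i j eq → <⇒≢ 3<n (trans (sym eq) (sum-ones (λ i → suc zero , (i , j)))))
      {x} {y}

    least : ∀ k → 1 ≤ k → ClosedDistinguishable G k → 2 ≤ k
    least 1             _ (g , bounded , cd) = contradiction
      (trans (g≡1 (α zero)) (sym (g≡1 (β zero)))) (distinguishing⇒proper cd zero zero)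
      where
      g≡1 : ∀ x → g x ≡ 1
      g≡1 x = ≤-antisym (proj₂ (bounded x)) (proj₁ (bounded x))
    least (suc (suc k)) _ _ = s≤s (s≤s z≤n)

  -- Upper bound on the choice number.

  choosable : 2 ≤ n → ClosedDistinguishingChoosable G (suc n)
  choosable 2≤n L L! L⁺ = f , f∈L , f-distinguishing
    where
    choose : ∀ x ys → length ys ≤ n → ∃[ a ] (a ∈ᵥ L x × a ∉ ys)
    choose x ys ys≤n = pick-outside (L! x) ys (s≤s ys≤n)

    free : Vertex → ℕ
    free x = proj₁ (choose x [] z≤n)

    -- Each `β j` has to avoid these at most `n` labels, so a list of `suc n` entries suffices.
    αs : List ℕ
    αs = map (λ i → free (α i)) (allFin n)

    αs-length : length αs ≤ n
    αs-length = ≤-reflexive (trans (length-map _ (allFin n)) (length-tabulate {n = n} id))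

    -- Once the labels of all `u` and `v` vertices are fixed, `us-sum` and `vs-sum` each forbid at
    -- most one label at `w i j`. The label of `w i j` enters no other triangle, so these choices
    -- are independent.
    at-w : ∀ i j → ∃[ a ] (a ∈ᵥ L (w i j) × a ∉ _)
    at-w i j = choose (w i j)
      (sum (map free (us i)) ∸ (free (u i j) + free (v i j)) ∷
       sum (map free (vs j)) ∸ (free (u i j) + free (v i j)) ∷ []) 2≤n

    chosen : ∀ x → ∃[ a ] a ∈ᵥ L x
    chosen (α i)   = let a , a∈ , _ = choose (α i) [] z≤n in a , a∈
    chosen (β j)   = let a , a∈ , _ = choose (β j) αs αs-length in a , a∈
    chosen (u i j) = let a , a∈ , _ = choose (u i j) [] z≤n in a , a∈
    chosen (v i j) = let a , a∈ , _ = choose (v i j) [] z≤n in a , a∈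
    chosen (w i j) = let a , a∈ , _ = at-w i j in a , a∈

    f : Vertex → ℕ
    f x = proj₁ (chosen x)

    f∈L : ∀ x → f x ∈ᵥ L x
    f∈L x = proj₂ (chosen x)

    positive : ∀ x → 1 ≤ f x
    positive x = VecAll.lookup (L⁺ x) (f∈L x)

    -- The forbidden values in `at-w` are stated with `free`, since `f` is itself built from `at-w`.
    map-us : ∀ i js → map f (map (λ j → u i j) js) ≡ map free (map (λ j → u i j) js)
    map-us i []       = refl
    map-us i (_ ∷ js) = cong (_ ∷_) (map-us i js)

    map-vs : ∀ j is → map f (map (λ i → v i j) is) ≡ map free (map (λ i → v i j) is)
    map-vs j []       = refl
    map-vs j (_ ∷ is) = cong (_ ∷_) (map-vs j is)

    -- An actual coincidence of sums gives `s ≡ a + b`, so truncation of `s ∸ a` cannot hide a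
    -- forbidden label.
    solve-w : ∀ {s t} a b → s ≡ t → t ≡ a + b → b ≡ s ∸ a
    solve-w a b refl refl = sym (m+n∸m≡n a b)

    f-distinguishing : ClosedDistinguishing G f
    f-distinguishing {x} {y} = proper⇒distinguishing positive
      (λ i j eq → proj₂ (proj₂ (choose (β j) αs αs-length))
        (subst (_∈ αs) eq (∈-map⁺ (λ i → free (α i)) (∈-allFin i))))
      (λ i j eq → proj₂ (proj₂ (at-w i j))
        (here (solve-w _ _ (cong sum (sym (map-us i (allFin N)))) eq)))
      (λ i j eq → proj₂ (proj₂ (at-w i j))
        (there (here (solve-w _ _ (cong sum (sym (map-vs j (allFin n)))) eq))))
      {x} {y}

-- Lower bound on the choice number.

module _ (n : ℕ) where
  open Gadgets n (n ^ n)

  -- The vertices α i get disjoint lists indexed by Fin n × Fin k. The choice made on them is a function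
  -- Fin n → Fin n, and the vertex β indexed by that function has exactly the chosen labels in its list.
  not-choosable : ∀ {k} → k ≤ n → ¬ ClosedDistinguishingChoosable G k
  not-choosable {k} k≤n choosable-k = contradiction fα≡fβ (distinguishing⇒proper cd (ι c) (funToFin ψ))
    where
    ι : Fin k → Fin n
    ι i = inject≤ i k≤n

    ι-injective : ∀ {i j} → ι i ≡ ι j → i ≡ j
    ι-injective = inject≤-injective k≤n k≤n _ _

    -- An injective code for pairs, shifted by one to be positive; the first component keeps the
    -- lists of different `α i` disjoint.
    label : Fin n → Fin n → ℕ
    label i c = suc (toℕ (combine i c))

    label-injective : ∀ {i c i′ c′} → label i c ≡ label i′ c′ → i ≡ i′ × c ≡ c′
    label-injective eq = combine-injective _ _ _ _ (toℕ-injective (suc-injective eq))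

    entry : Vertex → Fin k → ℕ
    entry (α i)    c = label i (ι c)
    -- One label for each of the `k` vertices `α (ι c)`, namely the one that the function coded by
    -- `φ` selects there.
    entry (β φ)    c = label (ι c) (finToFun φ (ι c))
    entry (inj₂ _) c = suc (toℕ c)

    entry-injective : ∀ x {c d} → entry x c ≡ entry x d → c ≡ d
    entry-injective (α i)    eq = ι-injective (proj₂ (label-injective eq))
    entry-injective (β φ)    eq = ι-injective (proj₁ (label-injective eq))
    entry-injective (inj₂ _) eq = toℕ-injective (suc-injective eq)

    entry-positive : ∀ x c → 1 ≤ entry x c
    entry-positive (α i)    c = s≤s z≤n
    entry-positive (β φ)    c = s≤s z≤n
    entry-positive (inj₂ _) c = s≤s z≤n

    labeling : _
    labeling = choosable-k (tabulate ∘ entry) (λ x → VecUnique.tabulate⁺ (entry-injective x))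
      (λ x → VecAllₚ.tabulate⁺ (entry-positive x))

    f : Vertex → ℕ
    f = proj₁ labeling

    cd : ClosedDistinguishing G f
    cd {x} {y} = proj₂ (proj₂ labeling) {x} {y}

    index : ∀ x → ∃[ c ] f x ≡ entry x c
    index x = VecAnyₚ.tabulate⁻ (proj₁ (proj₂ labeling) x)

    ψ : Fin n → Fin n
    ψ i = ι (proj₁ (index (α i)))

    -- Whichever entry is taken at this `β`, its position `c` names a vertex `α (ι c)` with the same
    -- label.
    c : Fin k
    c = proj₁ (index (β (funToFin ψ)))

    fα≡fβ : f (α (ι c)) ≡ f (β (funToFin ψ))
    fα≡fβ = trans (proj₂ (index (α (ι c))))
      (trans (cong (label (ι c)) (sym (finToFun-funToFin ψ (ι c)))) (sym (proj₂ (index (β (funToFin ψ))))))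

  disₗ≡1+n : 2 ≤ n → disₗ[ G ]≡ suc n
  disₗ≡1+n 2≤n = s≤s z≤n , choosable 2≤n , λ k _ choosable-k → ≰⇒> (λ k≤n → not-choosable k≤n choosable-k)

-- The gap between the two numbers.

theorem1 : ∀ (t : ℕ) → 1 ≤ t →
    ∃[ G ] ∃[ d ] ∃[ dₗ ]
    ((dis[ G ]≡ d) × (disₗ[ G ]≡ dₗ) × ((+ dₗ) - (+ d) ≥ + t))
theorem1 t _ =
  Gadgets.G n (n ^ n) , 2 , suc n ,
  Gadgets.dis≡2 n (n ^ n) 3<n (≤-trans 3<n n≤n^n) , disₗ≡1+n n (s≤s (s≤s z≤n)) , ℤ.+≤+ (m≤n+m t 3)
  where
  -- The summand 4 secures `3 < n` for `dis≡2`; the gap is then `suc n` minus 2, which is `3 + t`.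
  n : ℕ
  n = 4 + t

  3<n : 3 < n
  3<n = m≤m+n 4 t

  n≤n^n : n ≤ n ^ n
  n≤n^n = m≤m*n n (n ^ (3 + t)) {{m^n≢0 n (3 + t)}}
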